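{- Every integral implicative lattice $\mathbf{L}$ is a reduct of an integral residuated lattice $\mathbf{R}$. If $\mathbf{D}$ is a distributive integral implicative lattice, then it is a reduct of a residuated Heyting algebra $\mathbf{H}$. In both cases $\mathbf{R}$, $\mathbf{H}$ are constructed as a canonical extension of $\mathbf{L}$, respectively $\mathbf{D}$, and they are therefore unique up to an isomorphism that fixes $\mathbf{L}$ (respectively $\mathbf{D}$).
   Context: An integral implicative lattice is a bounded lattice $(L,\leq,\wedge,\vee,0,1,\to)$ with a binary operation $\to$ satisfying, for all $a,b,c$: (A1) $(a\vee b)\to c=(a\to c)\wedge(b\to c)$; (A2) $a\to(b\wedge c)=(a\to b)\wedge(a\to c)$; (A3) $a\leq b$ iff $1\leq a\to b$. It is distributive if its lattice reduct is distributive. An integral residuated lattice is a bounded lattice with binary operations $\circ,\backslash,/$ that are residuated ($a\circ b\leq c$ iff $b\leq a\backslash c$ iff $a\leq c/b$), integral in the usual sense of substructural logic; the implicative lattice appears as the reduct with $\backslash$ in the role of $\to$. A residuated Heyting algebra is a structure $(H,\leq,\wedge,\vee,0,1,\to,/,\circ,\backslash)$ such that $(H,\leq,\wedge,\vee,0,1,\to)$ is a Heyting algebra ($\to$ is the residual of $\wedge$), $(H,\leq,\wedge,\vee,0,1,/,\circ,\backslash)$ is a distributive integral residuated lattice, and $(H,\leq,\wedge,\vee,0,1,\backslash)$ is an integral implicative lattice. Canonical extension is in the sense of Gehrke–Harding.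
   Formalization: "Integral" for a residuated lattice is taken as a∘1 = a (1 a right unit; equivalently a ≤ b iff 1 ≤ a\b), without 1∘a = a: a two-sided unit would force 1→a = a in L, which fails on the 3-chain with a→b = 1 if a ≤ b and 0 otherwise. Associativity of ∘ is not required. -}

module Defs where

open import Level using (Level; _⊔_; Setω) renaming (suc to lsuc)
open import Data.Product using (Σ; ∃; _×_; _,_)
open import Data.Sum using (_⊎_)
open import Data.List using (List; map; foldr)
open import Relation.Nullary using (¬_)
open import Relation.Binary.Core using (_Preserves₂_⟶_⟶_)
open import Relation.Binary.Lattice.Bundles using (BoundedLattice)
open import Relation.Binary.Lattice.Structures using (IsHeytingAlgebra)
open import Algebra.Definitions using (_DistributesOverˡ_)

-- Classical metatheory (the paper works in ZFC)

ExcludedMiddle : Setω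
ExcludedMiddle = ∀ {ℓ} (P : Set ℓ) → P ⊎ ¬ P

module _ {c ℓ₁ ℓ₂} (C : BoundedLattice c ℓ₁ ℓ₂) where
  open BoundedLattice C

  IsLubOf : ∀ {p} → (Carrier → Set p) → Carrier → Set (c ⊔ ℓ₂ ⊔ p)
  IsLubOf P s = (∀ w → P w → w ≤ s) × (∀ u → (∀ w → P w → w ≤ u) → s ≤ u)

  IsGlbOf : ∀ {p} → (Carrier → Set p) → Carrier → Set (c ⊔ ℓ₂ ⊔ p)
  IsGlbOf P s = (∀ w → P w → s ≤ w) × (∀ u → (∀ w → P w → u ≤ w) → u ≤ s)

  IsLub : ∀ {i} {I : Set i} → (I → Carrier) → Carrier → Set (c ⊔ ℓ₂ ⊔ i)
  IsLub f s = (∀ j → f j ≤ s) × (∀ u → (∀ j → f j ≤ u) → s ≤ u)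

  IsGlb : ∀ {i} {I : Set i} → (I → Carrier) → Carrier → Set (c ⊔ ℓ₂ ⊔ i)
  IsGlb f s = (∀ j → s ≤ f j) × (∀ u → (∀ j → u ≤ f j) → u ≤ s)

  ⋀-list : List Carrier → Carrier
  ⋀-list = foldr _∧_ ⊤

  ⋁-list : List Carrier → Carrier
  ⋁-list = foldr _∨_ ⊥

record ImplicativeLattice c ℓ₁ ℓ₂ : Set (lsuc (c ⊔ ℓ₁ ⊔ ℓ₂)) where
  field
    boundedLattice : BoundedLattice c ℓ₁ ℓ₂
  open BoundedLattice boundedLattice public
  infixr 5 _⇒_
  field
    _⇒_  : Carrier → Carrier → Carrier
    ⇒-cong : _⇒_ Preserves₂ _≈_ ⟶ _≈_ ⟶ _≈_
    A1 : ∀ a b c → ((a ∨ b) ⇒ c) ≈ ((a ⇒ c) ∧ (b ⇒ c))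
    A2 : ∀ a b c → (a ⇒ (b ∧ c)) ≈ ((a ⇒ b) ∧ (a ⇒ c))
    A3 : ∀ a b → (a ≤ b → ⊤ ≤ (a ⇒ b)) × (⊤ ≤ (a ⇒ b) → a ≤ b)

record DistributiveImplicativeLattice c ℓ₁ ℓ₂ : Set (lsuc (c ⊔ ℓ₁ ⊔ ℓ₂)) where
  field
    implicativeLattice : ImplicativeLattice c ℓ₁ ℓ₂
  open ImplicativeLattice implicativeLattice public
  field
    ∧-distribˡ-∨ : _DistributesOverˡ_ _≈_ _∧_ _∨_

-- Integral residuated lattices (not assumed associative / unital)
--   a · b ≤ c  iff  b ≤ a ⧹ c  iff  a ≤ c ⧸ b ;  integral: ⊤ is a right unit

record IntegralResiduatedLattice c ℓ₁ ℓ₂ : Set (lsuc (c ⊔ ℓ₁ ⊔ ℓ₂)) where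
  field
    boundedLattice : BoundedLattice c ℓ₁ ℓ₂
  open BoundedLattice boundedLattice public
  field
    _·_ _⧹_ _⧸_ : Carrier → Carrier → Carrier
    ·-cong : _·_ Preserves₂ _≈_ ⟶ _≈_ ⟶ _≈_
    ⧹-cong : _⧹_ Preserves₂ _≈_ ⟶ _≈_ ⟶ _≈_
    ⧸-cong : _⧸_ Preserves₂ _≈_ ⟶ _≈_ ⟶ _≈_
    residuated₁ : ∀ a b c → (a · b ≤ c → b ≤ a ⧹ c) × (b ≤ a ⧹ c → a · b ≤ c)
    residuated₂ : ∀ a b c → (a · b ≤ c → a ≤ c ⧸ b) × (a ≤ c ⧸ b → a · b ≤ c)
    integral : ∀ a → (a · ⊤) ≈ a

record ResiduatedHeytingAlgebra c ℓ₁ ℓ₂ : Set (lsuc (c ⊔ ℓ₁ ⊔ ℓ₂)) where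
  field
    residuatedLattice : IntegralResiduatedLattice c ℓ₁ ℓ₂
  open IntegralResiduatedLattice residuatedLattice public
  field
    _⇨_ : Carrier → Carrier → Carrier
    isHeytingAlgebra : IsHeytingAlgebra _≈_ _≤_ _∨_ _∧_ _⇨_ ⊤ ⊥
    ∧-distribˡ-∨ : _DistributesOverˡ_ _≈_ _∧_ _∨_
    ⧹-A1 : ∀ a b c → ((a ∨ b) ⧹ c) ≈ ((a ⧹ c) ∧ (b ⧹ c))
    ⧹-A2 : ∀ a b c → (a ⧹ (b ∧ c)) ≈ ((a ⧹ b) ∧ (a ⧹ c))
    ⧹-A3 : ∀ a b → (a ≤ b → ⊤ ≤ (a ⧹ b)) × (⊤ ≤ (a ⧹ b) → a ≤ b)

-- Canonical extension of a bounded lattice (Gehrke–Harding), with the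
-- size of "arbitrary subsets" made explicit:
--   ιc : index level of the subsets of L in the compactness condition and in
--        the definition of closed / open elements,
--   ιd : index level of the families in completeness and density.

module _ {c ℓ₁ ℓ₂ c' ℓ₁' ℓ₂'}
         (L : BoundedLattice c ℓ₁ ℓ₂) (C : BoundedLattice c' ℓ₁' ℓ₂') where
  private
    module L = BoundedLattice L
    module C = BoundedLattice C

  record IsCanonicalExtension (ιc ιd : Level) (e : L.Carrier → C.Carrier)
         : Set (c ⊔ ℓ₁ ⊔ ℓ₂ ⊔ c' ⊔ ℓ₁' ⊔ ℓ₂' ⊔ lsuc (ιc ⊔ ιd)) where
    field
      e-cong      : ∀ {a b} → a L.≈ b → e a C.≈ e b
      e-injective : ∀ {a b} → e a C.≈ e b → a L.≈ b
      e-∧         : ∀ a b → e (a L.∧ b) C.≈ (e a C.∧ e b)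
      e-∨         : ∀ a b → e (a L.∨ b) C.≈ (e a C.∨ e b)
      e-⊤         : e L.⊤ C.≈ C.⊤
      e-⊥         : e L.⊥ C.≈ C.⊥
      complete-∨ : ∀ (I : Set ιd) (f : I → C.Carrier) → ∃ λ s → IsLub C f s
      complete-∧ : ∀ (I : Set ιd) (f : I → C.Carrier) → ∃ λ s → IsGlb C f s
      dense-∨∧ : ∀ x → Σ (Set ιd) λ J → Σ (J → Set ιd) λ I →
                   Σ ((j : J) → I j → L.Carrier) λ a → Σ (J → C.Carrier) λ m →
                   (∀ j → IsGlb C (λ i → e (a j i)) (m j)) × IsLub C m x
      dense-∧∨ : ∀ x → Σ (Set ιd) λ J → Σ (J → Set ιd) λ I →
                   Σ ((j : J) → I j → L.Carrier) λ a → Σ (J → C.Carrier) λ m →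
                   (∀ j → IsLub C (λ i → e (a j i)) (m j)) × IsGlb C m x
      compact : ∀ (I J : Set ιc) (S : I → L.Carrier) (T : J → L.Carrier) m s →
                  IsGlb C (λ i → e (S i)) m → IsLub C (λ j → e (T j)) s →
                  m C.≤ s →
                  Σ (List I) λ is → Σ (List J) λ js →
                    ⋀-list L (map S is) L.≤ ⋁-list L (map T js)

  IsClosed : (ιc : Level) → (L.Carrier → C.Carrier) → C.Carrier
             → Set (c ⊔ c' ⊔ ℓ₂' ⊔ lsuc ιc)
  IsClosed ιc e k = Σ (Set ιc) λ I → Σ (I → L.Carrier) λ S → IsGlb C (λ i → e (S i)) k

  IsOpen : (ιc : Level) → (L.Carrier → C.Carrier) → C.Carrier
           → Set (c ⊔ c' ⊔ ℓ₂' ⊔ lsuc ιc)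
  IsOpen ιc e o = Σ (Set ιc) λ I → Σ (I → L.Carrier) λ S → IsLub C (λ i → e (S i)) o

  -- g is the π-extension of the binary operation f : L^∂ × L → L
  -- (order-preserving from L^∂ × L to L), i.e. for open elements (k , o) of
  -- C^∂ × C (k closed, o open in C)
  --   g^π(k , o) = ⋁ { e (f a b) : k ≤ e a , e b ≤ o }
  -- and  g(x , y) = ⋀ { g^π(k , o) : k ≤ x , y ≤ o , k closed , o open }.
  IsPiExtension⇒ : (ιc : Level) → (e : L.Carrier → C.Carrier)
                   → (f : L.Carrier → L.Carrier → L.Carrier)
                   → (g : C.Carrier → C.Carrier → C.Carrier)
                   → Set _
  IsPiExtension⇒ ιc e f g = ∀ x y → IsGlbOf C
    (λ w → Σ C.Carrier λ k → Σ C.Carrier λ o →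
             IsClosed ιc e k × IsOpen ιc e o × k C.≤ x × y C.≤ o ×
             IsLubOf C (λ v → Σ L.Carrier λ a → Σ L.Carrier λ b →
                                (k C.≤ e a) × (e b C.≤ o) × (v C.≈ e (f a b))) w)
    (g x y)

-- The canonical integral residuated lattice over an implicative lattice:
-- lattice reduct is a canonical extension of L via e, e turns → into ⧹
-- (so L is a reduct of R), and ⧹ is the π-extension of →.

module _ {c ℓ₁ ℓ₂ c' ℓ₁' ℓ₂'}
         (L : ImplicativeLattice c ℓ₁ ℓ₂) (R : IntegralResiduatedLattice c' ℓ₁' ℓ₂') where
  private
    module L = ImplicativeLattice L
    module R = IntegralResiduatedLattice R

  sizeL : Level
  sizeL = c ⊔ ℓ₁ ⊔ ℓ₂

  record IsCanonicalResExt (e : L.Carrier → R.Carrier)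
         : Set (lsuc (lsuc (c ⊔ ℓ₁ ⊔ ℓ₂)) ⊔ lsuc (c' ⊔ ℓ₁' ⊔ ℓ₂')) where
    field
      canonical : IsCanonicalExtension L.boundedLattice R.boundedLattice
                    sizeL (lsuc sizeL) e
      e-⇒       : ∀ a b → e (a L.⇒ b) R.≈ (e a R.⧹ e b)
      ⧹-is-π    : IsPiExtension⇒ L.boundedLattice R.boundedLattice sizeL e L._⇒_ R._⧹_

module _ {c c' ℓ₁' ℓ₂' c'' ℓ₁'' ℓ₂''} {A : Set c}
         (R : IntegralResiduatedLattice c' ℓ₁' ℓ₂')
         (R' : IntegralResiduatedLattice c'' ℓ₁'' ℓ₂'')
         (e : A → IntegralResiduatedLattice.Carrier R)
         (e' : A → IntegralResiduatedLattice.Carrier R') where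
  private
    module R = IntegralResiduatedLattice R
    module R' = IntegralResiduatedLattice R'

  record IsoFixing : Set (c ⊔ c' ⊔ ℓ₁' ⊔ ℓ₂' ⊔ c'' ⊔ ℓ₁'' ⊔ ℓ₂'') where
    field
      to      : R.Carrier → R'.Carrier
      from    : R'.Carrier → R.Carrier
      to-cong   : ∀ {x y} → x R.≈ y → to x R'.≈ to y
      from-cong : ∀ {x y} → x R'.≈ y → from x R.≈ from y
      from-to : ∀ x → from (to x) R.≈ x
      to-from : ∀ y → to (from y) R'.≈ y
      to-order : ∀ x y → (x R.≤ y → to x R'.≤ to y) × (to x R'.≤ to y → x R.≤ y)
      to-∧ : ∀ x y → to (x R.∧ y) R'.≈ (to x R'.∧ to y)
      to-∨ : ∀ x y → to (x R.∨ y) R'.≈ (to x R'.∨ to y)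
      to-⊤ : to R.⊤ R'.≈ R'.⊤
      to-⊥ : to R.⊥ R'.≈ R'.⊥
      to-· : ∀ x y → to (x R.· y) R'.≈ (to x R'.· to y)
      to-⧹ : ∀ x y → to (x R.⧹ y) R'.≈ (to x R'.⧹ to y)
      to-⧸ : ∀ x y → to (x R.⧸ y) R'.≈ (to x R'.⧸ to y)
      fixes : ∀ a → to (e a) R'.≈ e' a

module _ {c c' ℓ₁' ℓ₂' c'' ℓ₁'' ℓ₂''} {A : Set c}
         (H : ResiduatedHeytingAlgebra c' ℓ₁' ℓ₂')
         (H' : ResiduatedHeytingAlgebra c'' ℓ₁'' ℓ₂'')
         (e : A → ResiduatedHeytingAlgebra.Carrier H)
         (e' : A → ResiduatedHeytingAlgebra.Carrier H') where
  private
    module H = ResiduatedHeytingAlgebra H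
    module H' = ResiduatedHeytingAlgebra H'

  IsoFixingRHA : Set (c ⊔ c' ⊔ ℓ₁' ⊔ ℓ₂' ⊔ c'' ⊔ ℓ₁'' ⊔ ℓ₂'')
  IsoFixingRHA = Σ (IsoFixing H.residuatedLattice H'.residuatedLattice e e') λ φ →
                   ∀ x y → IsoFixing.to φ (x H.⇨ y) H'.≈ (IsoFixing.to φ x H'.⇨ IsoFixing.to φ y)

{-# OPTIONS --safe #-}
-- R consists of the sets of filters of L that are Galois-stable for the
-- relation "the filter F meets the ideal I".  On filters put
--   F ∘ G = { b : a ⇒ b ∈ G for some a ∈ F }.
-- By A1 and A2, for fixed I and fixed F (resp. G) the condition that F ∘ G meets
-- I says that G (resp. F) meets a certain ideal.  Hence the stable
-- sets are closed under both residuals of the complex product, and A3 makes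
-- the principal filter of ⊤ a right unit.  If L is distributive, the join of
-- filters is adjoint to ideals in the same way, and its complex product is
-- intersection, so the stable sets form a Heyting algebra.
-- In any canonical extension C write κ F = ⋀ e[F] and ω I = ⋁ e[I].  Compactness
-- says that κ F ≤ ω I iff F meets I, and density that x ↦ { F : κ F ≤ x } is an
-- order isomorphism from C onto the stable sets.  The π-extension of ⇒ is
-- determined by which pairs κ F, ω I it relates, so the isomorphism
-- preserves it, and then every operation defined from it by residuation.
module Submission where

open import Defs
open import Level using (Level; _⊔_; Lift; lift; lower) renaming (suc to lsuc)
open import Data.Product using (Σ; _×_; _,_; proj₁; proj₂)
open import Data.Sum using (_⊎_; inj₁; inj₂; [_,_])
open import Data.Empty using (⊥-elim) renaming (⊥ to Empty)
open import Data.Unit using (tt) renaming (⊤ to Unit)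
open import Data.List using (List; []; _∷_; _++_; map)
open import Function using (flip)
open import Relation.Binary.PropositionalEquality using (_≡_; refl)
open import Relation.Nullary using (¬_)
open import Relation.Binary.Lattice.Bundles using (BoundedLattice; HeytingAlgebra)
open import Relation.Binary.Lattice.Structures using (IsHeytingAlgebra)
import Relation.Binary.Lattice.Properties.MeetSemilattice as MeetProperties
import Relation.Binary.Lattice.Properties.JoinSemilattice as JoinProperties
import Relation.Binary.Lattice.Properties.HeytingAlgebra as HeytingProperties

-- Universe changes for propositions

module Resizing (em : ExcludedMiddle) where

  -- Excluded middle makes every type logically equivalent to a unit or an empty type of any level.
  -- So the order of an extension in unrelated universes can serve as membership in a filter or a
  -- stable set.
  Resize : ∀ {p} q → Set p → Set q
  Resize q P = decide (em P)
    where
    decide : P ⊎ ¬ P → Set q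
    decide (inj₁ _) = Lift q Unit
    decide (inj₂ _) = Lift q Empty

  shrink : ∀ {p q} {P : Set p} → P → Resize q P
  shrink {P = P} x with em P
  ... | inj₁ _ = lift tt
  ... | inj₂ ¬x = ⊥-elim (¬x x)

  unshrink : ∀ {p q} {P : Set p} → Resize q P → P
  unshrink {P = P} r with em P | r
  ... | inj₁ x | _ = x
  ... | inj₂ _ | ()

-- Filters and ideals

module Polarity {c ℓ₁ ℓ₂} (L : BoundedLattice c ℓ₁ ℓ₂) where
  open BoundedLattice L

  size : Level
  size = c ⊔ ℓ₁ ⊔ ℓ₂

  record Filter : Set (lsuc size) where
    field
      mem : Carrier → Set size
      up : ∀ {a b} → a ≤ b → mem a → mem b
      ⊤-mem : mem ⊤
      ∧-mem : ∀ {a b} → mem a → mem b → mem (a ∧ b)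

  record Ideal : Set (lsuc size) where
    field
      mem : Carrier → Set size
      down : ∀ {a b} → a ≤ b → mem b → mem a
      ⊥-mem : mem ⊥
      ∨-mem : ∀ {a b} → mem a → mem b → mem (a ∨ b)

  infix 4 _∈ᶠ_ _∈ⁱ_ _⊆_ _≬_

  _∈ᶠ_ : Carrier → Filter → Set size
  a ∈ᶠ F = Filter.mem F a

  _∈ⁱ_ : Carrier → Ideal → Set size
  a ∈ⁱ I = Ideal.mem I a

  _⊆_ : Filter → Filter → Set size
  F ⊆ G = ∀ a → a ∈ᶠ F → a ∈ᶠ G

  _≬_ : Filter → Ideal → Set size
  F ≬ I = Σ Carrier λ a → a ∈ᶠ F × a ∈ⁱ I

  ∧-mono : ∀ {a a' b b'} → a ≤ a' → b ≤ b' → a ∧ b ≤ a' ∧ b'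
  ∧-mono p q = ∧-greatest (trans (x∧y≤x _ _) p) (trans (x∧y≤y _ _) q)

  ∨-mono : ∀ {a a' b b'} → a ≤ a' → b ≤ b' → a ∨ b ≤ a' ∨ b'
  ∨-mono p q = ∨-least (trans p (x≤x∨y _ _)) (trans q (y≤x∨y _ _))

  ≤-refl : ∀ {a} → a ≤ a
  ≤-refl = reflexive Eq.refl

  ↑ : Carrier → Filter
  ↑ a = record
    { mem = λ b → Lift size (a ≤ b)
    ; up = λ p q → lift (trans (lower q) p)
    ; ⊤-mem = lift (maximum a)
    ; ∧-mem = λ p q → lift (∧-greatest (lower p) (lower q))
    }

  ↓ : Carrier → Ideal
  ↓ a = record
    { mem = λ b → Lift size (b ≤ a)
    ; down = λ p q → lift (trans p (lower q))
    ; ⊥-mem = lift (minimum a)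
    ; ∨-mem = λ p q → lift (∨-least (lower p) (lower q))
    }

  ↑-≬ : ∀ {a I} → ↑ a ≬ I → a ∈ⁱ I
  ↑-≬ {I = I} (b , lift a≤b , Ib) = Ideal.down I a≤b Ib

  ≬-↓ : ∀ {F a} → F ≬ ↓ a → a ∈ᶠ F
  ≬-↓ {F} (b , Fb , lift b≤a) = Filter.up F b≤a Fb

  ⋀-mem : ∀ (F : Filter) (as : List (Σ Carrier (_∈ᶠ F))) → ⋀-list L (map proj₁ as) ∈ᶠ F
  ⋀-mem F [] = Filter.⊤-mem F
  ⋀-mem F ((_ , p) ∷ as) = Filter.∧-mem F p (⋀-mem F as)

  ⋁-mem : ∀ (I : Ideal) (as : List (Σ Carrier (_∈ⁱ I))) → ⋁-list L (map proj₁ as) ∈ⁱ I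
  ⋁-mem I [] = Ideal.⊥-mem I
  ⋁-mem I ((_ , p) ∷ as) = Ideal.∨-mem I p (⋁-mem I as)

  module _ {A : Set size} (S : A → Carrier) where

    ⋀-++ : ∀ is js → ⋀-list L (map S (is ++ js)) ≤ ⋀-list L (map S is) ∧ ⋀-list L (map S js)
    ⋀-++ [] js = ∧-greatest (maximum _) ≤-refl
    ⋀-++ (i ∷ is) js = ∧-greatest
      (∧-mono ≤-refl (trans (⋀-++ is js) (x∧y≤x _ _)))
      (trans (x∧y≤y _ _) (trans (⋀-++ is js) (x∧y≤y _ _)))

    ⋁-++ : ∀ is js → ⋁-list L (map S is) ∨ ⋁-list L (map S js) ≤ ⋁-list L (map S (is ++ js))
    ⋁-++ [] js = ∨-least (minimum _) ≤-refl
    ⋁-++ (i ∷ is) js = ∨-least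
      (∨-mono ≤-refl (trans (x≤x∨y _ _) (⋁-++ is js)))
      (trans (trans (y≤x∨y _ _) (⋁-++ is js)) (y≤x∨y _ _))

    -- Membership carries the finite list, so that a filter meeting an ideal yields the two lists
    -- that `compact` returns.
    generatedFilter : Filter
    generatedFilter = record
      { mem = λ a → Lift size (Σ (List A) λ is → ⋀-list L (map S is) ≤ a)
      ; up = λ { a≤b (lift (is , p)) → lift (is , trans p a≤b) }
      ; ⊤-mem = lift ([] , ≤-refl)
      ; ∧-mem = λ { (lift (is , p)) (lift (js , q)) →
                    lift (is ++ js , trans (⋀-++ is js) (∧-mono p q)) }
      }

    generatedIdeal : Ideal
    generatedIdeal = record
      { mem = λ a → Lift size (Σ (List A) λ is → a ≤ ⋁-list L (map S is))
      ; down = λ { a≤b (lift (is , p)) → lift (is , trans a≤b p) }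
      ; ⊥-mem = lift ([] , ≤-refl)
      ; ∨-mem = λ { (lift (is , p)) (lift (js , q)) →
                    lift (is ++ js , trans (∨-mono p q) (⋁-++ is js)) }
      }

    generatedFilter-∋ : ∀ i → S i ∈ᶠ generatedFilter
    generatedFilter-∋ i = lift (i ∷ [] , x∧y≤x _ _)

    generatedIdeal-∋ : ∀ i → S i ∈ⁱ generatedIdeal
    generatedIdeal-∋ i = lift (i ∷ [] , x≤x∨y _ _)

-- Stable sets of filters

module StableSets {c ℓ₁ ℓ₂} (L : BoundedLattice c ℓ₁ ℓ₂) where
  private module L = BoundedLattice L
  open Polarity L

  _BoundedBy_ : (Filter → Set (lsuc size)) → Ideal → Set (lsuc size)
  P BoundedBy I = ∀ F → P F → F ≬ I

  record Stable : Set (lsuc (lsuc size)) where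
    field
      mem : Filter → Set (lsuc size)
      stable : ∀ F → (∀ I → mem BoundedBy I → F ≬ I) → mem F
  open Stable public

  infix 4 _⊑_ _≋_

  _⊑_ : Stable → Stable → Set (lsuc size)
  x ⊑ y = ∀ F → mem x F → mem y F

  _≋_ : Stable → Stable → Set (lsuc size)
  x ≋ y = x ⊑ y × y ⊑ x

  closure : (Filter → Set (lsuc size)) → Stable
  closure P = record
    { mem = λ F → ∀ I → P BoundedBy I → F ≬ I
    ; stable = λ F h I b → h I (λ G g → g I b)
    }

  closure-incl : ∀ P F → P F → mem (closure P) F
  closure-incl P F p I b = b F p

  closure-least : ∀ P y → (∀ F → P F → mem y F) → closure P ⊑ y
  closure-least P y P⊆y F h = stable y F λ I b → h I λ G p → b G (P⊆y G p)

  -- A larger filter meets every ideal that the smaller one meets.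
  upset : ∀ x {F G} → F ⊆ G → mem x F → mem x G
  upset x {F} {G} F⊆G p = stable x G λ I b →
    let a , Fa , Ia = b F p in a , F⊆G a Fa , Ia

  ⋂ : {A : Set (lsuc size)} → (A → Stable) → Stable
  ⋂ f = record
    { mem = λ F → ∀ i → mem (f i) F
    ; stable = λ F h i → stable (f i) F λ I b → h I λ G g → b G (g i)
    }

  _⊓_ : Stable → Stable → Stable
  x ⊓ y = record
    { mem = λ F → mem x F × mem y F
    ; stable = λ F h →
        stable x F (λ I b → h I λ G g → b G (proj₁ g)) ,
        stable y F (λ I b → h I λ G g → b G (proj₂ g))
    }

  _⊔ˢ_ : Stable → Stable → Stable
  x ⊔ˢ y = closure λ F → mem x F ⊎ mem y F

  stableLattice : BoundedLattice (lsuc (lsuc size)) (lsuc size) (lsuc size)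
  stableLattice = record
    { Carrier = Stable
    ; _≈_ = _≋_
    ; _≤_ = _⊑_
    ; _∨_ = _⊔ˢ_
    ; _∧_ = _⊓_
    ; ⊤ = record { mem = λ _ → Lift _ Unit ; stable = λ _ _ → lift tt }
    ; ⊥ = closure λ _ → Lift _ Empty
    ; isBoundedLattice = record
      { isLattice = record
        { isPartialOrder = record
          { isPreorder = record
            { isEquivalence = record
              { refl = (λ F p → p) , (λ F p → p)
              ; sym = λ { (p , q) → q , p }
              ; trans = λ { (p , q) (p' , q') →
                  (λ F r → p' F (p F r)) , (λ F r → q F (q' F r)) }
              }
            ; reflexive = proj₁
            ; trans = λ p q F r → q F (p F r)
            }
          ; antisym = _,_
          }
        ; supremum = λ x y →
            (λ F p → closure-incl _ F (inj₁ p)) ,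
            (λ F p → closure-incl _ F (inj₂ p)) ,
            (λ z p q → closure-least _ z λ F → [ p F , q F ])
        ; infimum = λ x y →
            (λ F → proj₁) , (λ F → proj₂) , (λ z p q F r → p F r , q F r)
        }
      ; maximum = λ _ _ _ → lift tt
      ; minimum = λ x → closure-least _ x λ { _ () }
      }
    }

  closedAt : Filter → Stable
  closedAt F = record
    { mem = λ G → Lift _ (F ⊆ G)
    -- For `a` in `F` the ideal `↓ a` meets every filter above `F`, so `G` meets it and contains
    -- `a`.
    ; stable = λ G h → lift λ a Fa →
        ≬-↓ {G} (h (↓ a) λ { H (lift F⊆H) → a , F⊆H a Fa , lift ≤-refl })
    }

  openAt : Ideal → Stable
  openAt I = record
    { mem = λ F → Lift _ (F ≬ I)
    ; stable = λ F h → lift (h I λ G → lower)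
    }

  -- The same filters as in `closedAt (↑ a)` and in `openAt (↓ a)`: images of `L` are both closed
  -- and open.
  embed : L.Carrier → Stable
  embed a = record
    { mem = λ F → Lift _ (a ∈ᶠ F)
    ; stable = λ F h → lift (≬-↓ {F} (h (↓ a) λ { G (lift Ga) → a , Ga , lift ≤-refl }))
    }

  closedAt-glb : ∀ F → IsGlb stableLattice {I = Lift (lsuc size) (Σ L.Carrier (_∈ᶠ F))}
                         (λ p → embed (proj₁ (lower p))) (closedAt F)
  closedAt-glb F =
    (λ { (lift (a , Fa)) G (lift F⊆G) → lift (F⊆G a Fa) }) ,
    (λ u h G uG → lift λ a Fa → lower (h (lift (a , Fa)) G uG))

  openAt-lub : ∀ I → IsLub stableLattice {I = Lift (lsuc size) (Σ L.Carrier (_∈ⁱ I))}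
                       (λ p → embed (proj₁ (lower p))) (openAt I)
  openAt-lub I =
    (λ { (lift (a , Ia)) G (lift Ga) → lift (a , Ga , Ia) }) ,
    (λ { u h G (lift (a , Ga , Ia)) → h (lift (a , Ia)) G (lift Ga) })

  embed-mono : ∀ {a b} → a L.≤ b → embed a ⊑ embed b
  embed-mono a≤b F (lift p) = lift (Filter.up F a≤b p)

  embed-reflects : ∀ {a b} → embed a ⊑ embed b → a L.≤ b
  embed-reflects {a} h = lower (lower (h (↑ a) (lift (lift ≤-refl))))

  embed-canonical : IsCanonicalExtension L stableLattice size (lsuc size) embed
  embed-canonical = record
    { e-cong = λ p → embed-mono (L.reflexive p) , embed-mono (L.reflexive (L.Eq.sym p))
    ; e-injective = λ { (p , q) → L.antisym (embed-reflects p) (embed-reflects q) }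
    ; e-∧ = λ a b →
        (λ { F (lift p) → lift (Filter.up F (L.x∧y≤x a b) p) , lift (Filter.up F (L.x∧y≤y a b) p) }) ,
        (λ { F (lift p , lift q) → lift (Filter.∧-mem F p q) })
    -- An ideal met by every filter that contains `a` or `b` is met by `↑ a` and `↑ b`. It then
    -- contains `a`, `b` and their join, which lies in `F`.
    ; e-∨ = λ a b →
        (λ { F (lift p) I h → a L.∨ b , p , Ideal.∨-mem I
               (↑-≬ {I = I} (h (↑ a) (inj₁ (lift (lift ≤-refl)))))
               (↑-≬ {I = I} (h (↑ b) (inj₂ (lift (lift ≤-refl))))) }) ,
        closure-least _ (embed (a L.∨ b)) (λ F →
          [ embed-mono (L.x≤x∨y a b) F , embed-mono (L.y≤x∨y a b) F ])
    ; e-⊤ = (λ _ _ → lift tt) , (λ F _ → lift (Filter.⊤-mem F))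
    ; e-⊥ = (λ { F (lift p) I _ → L.⊥ , p , Ideal.⊥-mem I }) ,
            closure-least _ (embed L.⊥) (λ { _ () })
    ; complete-∨ = λ A f →
        closure (λ F → Σ A λ i → mem (f i) F) ,
        (λ i F p → closure-incl _ F (i , p)) ,
        (λ u h → closure-least _ u λ { F (i , p) → h i F p })
    ; complete-∧ = λ A f → ⋂ f , (λ i F p → p i) , (λ u h F p i → h i F p)
    ; dense-∨∧ = λ x →
        Σ Filter (mem x) , (λ { (F , _) → Lift _ (Σ L.Carrier (_∈ᶠ F)) }) ,
        (λ _ p → proj₁ (lower p)) , (λ { (F , _) → closedAt F }) ,
        (λ { (F , _) → closedAt-glb F }) ,
        (λ { (F , p) G (lift F⊆G) → upset x F⊆G p }) ,
        (λ u h F p → h (F , p) F (lift λ _ r → r))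
    -- Stability makes `x` the meet of the open elements of its bounding ideals.
    ; dense-∧∨ = λ x →
        Σ Ideal (mem x BoundedBy_) , (λ { (I , _) → Lift _ (Σ L.Carrier (_∈ⁱ I)) }) ,
        (λ _ p → proj₁ (lower p)) , (λ { (I , _) → openAt I }) ,
        (λ { (I , _) → openAt-lub I }) ,
        (λ { (I , b) F p → lift (b F p) }) ,
        (λ u h F p → stable x F λ I b → lower (h (I , b) F p))
    -- `closedAt F` is a lower bound of the images of `S`, so `F` belongs to `m` and hence to `s`.
    -- As `openAt I` is an upper bound of the images of `T`, `F` meets `I`.
    ; compact = λ A B S T m s m-glb s-lub m≤s →
        let F = generatedFilter S
            I = generatedIdeal T
            F∈m = proj₂ m-glb (closedAt F)
                    (λ { i G (lift F⊆G) → lift (F⊆G (S i) (generatedFilter-∋ S i)) })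
                    F (lift λ _ r → r)
            a , lift (is , p) , lift (js , q) = lower
              (proj₂ s-lub (openAt I)
                (λ { j G (lift Gt) → lift (T j , Gt , generatedIdeal-∋ T j) })
                F (m≤s F F∈m))
        in is , js , L.trans p q
    }

  module Residual
    (_∙_ : Filter → Filter → Filter) (adj : Filter → Ideal → Ideal)
    (to-adj : ∀ F G I → (F ∙ G) ≬ I → G ≬ adj F I)
    (from-adj : ∀ F G I → G ≬ adj F I → (F ∙ G) ≬ I)
    where

    -- If `I` bounds `y` and `F` is in `x`, then `adj F I` bounds the residual. Testing `G` against
    -- these ideals gives stability.
    residual : Stable → Stable → Stable
    residual x y = record
      { mem = λ G → ∀ F → mem x F → mem y (F ∙ G)
      ; stable = λ G h F Fx → stable y (F ∙ G) λ I b →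
          from-adj F G I (h (adj F I) λ H k → to-adj F H I (b (F ∙ H) (k F Fx)))
      }

    residual-mono : ∀ {x x' y y'} → x' ⊑ x → y ⊑ y' → residual x y ⊑ residual x' y'
    residual-mono p q G h F Fx = q (F ∙ G) (h F (p F Fx))

-- The residuated lattice of stable sets

module ImplicationFilters {c ℓ₁ ℓ₂} (L : ImplicativeLattice c ℓ₁ ℓ₂) where
  open ImplicativeLattice L
  open Polarity boundedLattice

  -- A2 at the meet `b ∧ b'`, which equals `b`; the left argument uses A1 in the same way.
  ⇒-monoʳ : ∀ {a b b'} → b ≤ b' → a ⇒ b ≤ a ⇒ b'
  ⇒-monoʳ {a} {b} {b'} p = trans
    (reflexive (Eq.trans (⇒-cong Eq.refl
      (Eq.sym (Eq.trans (MeetProperties.∧-comm meetSemilattice b b')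
                        (MeetProperties.y≤x⇒x∧y≈y meetSemilattice p)))) (A2 a b b')))
    (x∧y≤y _ _)

  ⇒-monoˡ : ∀ {a a' b} → a' ≤ a → a ⇒ b ≤ a' ⇒ b
  ⇒-monoˡ {a} {a'} {b} p = trans
    (reflexive (Eq.trans
      (⇒-cong (Eq.sym (JoinProperties.x≤y⇒x∨y≈y joinSemilattice p)) Eq.refl) (A1 a' a b)))
    (x∧y≤x _ _)

  ⇒-mono : ∀ {a a' b b'} → a' ≤ a → b ≤ b' → a ⇒ b ≤ a' ⇒ b'
  ⇒-mono p q = trans (⇒-monoˡ p) (⇒-monoʳ q)

  ⇒-∧ : ∀ {a b b'} → (a ⇒ b) ∧ (a ⇒ b') ≤ a ⇒ (b ∧ b')
  ⇒-∧ = reflexive (Eq.sym (A2 _ _ _))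

  ⇒-∨ : ∀ {a a' b} → (a ⇒ b) ∧ (a' ⇒ b) ≤ (a ∨ a') ⇒ b
  ⇒-∨ = reflexive (Eq.sym (A1 _ _ _))

  ⇒-true : ∀ (G : Filter) {a b} → a ≤ b → (a ⇒ b) ∈ᶠ G
  ⇒-true G p = Filter.up G (proj₁ (A3 _ _) p) (Filter.⊤-mem G)

  _∘_ : Filter → Filter → Filter
  F ∘ G = record
    { mem = λ b → Σ Carrier λ a → a ∈ᶠ F × (a ⇒ b) ∈ᶠ G
    ; up = λ { p (a , Fa , q) → a , Fa , Filter.up G (⇒-monoʳ p) q }
    ; ⊤-mem = ⊤ , Filter.⊤-mem F , ⇒-true G ≤-refl
    -- Both antecedents are lowered to `a ∧ a'`, after which A2 combines the consequents.
    ; ∧-mem = λ { (a , Fa , p) (a' , Fa' , p') →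
        a ∧ a' , Filter.∧-mem F Fa Fa' ,
        Filter.up G ⇒-∧ (Filter.∧-mem G
          (Filter.up G (⇒-monoˡ (x∧y≤x _ _)) p) (Filter.up G (⇒-monoˡ (x∧y≤y _ _)) p')) }
    }

  -- The elements `a ⇒ b` with `a` in `F` and `b` in `I` are upward directed, so the elements below
  -- one of them already form an ideal.
  _⇒ⁱ_ : Filter → Ideal → Ideal
  F ⇒ⁱ I = record
    { mem = λ d → Lift size (Σ Carrier λ a → Σ Carrier λ b → a ∈ᶠ F × b ∈ⁱ I × d ≤ a ⇒ b)
    ; down = λ { p (lift (a , b , Fa , Ib , q)) → lift (a , b , Fa , Ib , trans p q) }
    ; ⊥-mem = lift (⊤ , ⊥ , Filter.⊤-mem F , Ideal.⊥-mem I , minimum _)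
    ; ∨-mem = λ { (lift (a , b , Fa , Ib , q)) (lift (a' , b' , Fa' , Ib' , q')) →
        lift (a ∧ a' , b ∨ b' , Filter.∧-mem F Fa Fa' , Ideal.∨-mem I Ib Ib' ,
          ∨-least (trans q (⇒-mono (x∧y≤x _ _) (x≤x∨y _ _)))
                  (trans q' (⇒-mono (x∧y≤y _ _) (y≤x∨y _ _)))) }
    }

  _⇐ⁱ_ : Filter → Ideal → Ideal
  G ⇐ⁱ I = record
    { mem = λ a → Σ Carrier λ b → b ∈ⁱ I × (a ⇒ b) ∈ᶠ G
    ; down = λ { p (b , Ib , q) → b , Ib , Filter.up G (⇒-monoˡ p) q }
    ; ⊥-mem = ⊥ , Ideal.⊥-mem I , ⇒-true G ≤-refl
    -- Both consequents are raised to `b ∨ b'`, after which A1 combines the antecedents.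
    ; ∨-mem = λ { (b , Ib , p) (b' , Ib' , p') →
        b ∨ b' , Ideal.∨-mem I Ib Ib' ,
        Filter.up G ⇒-∨ (Filter.∧-mem G
          (Filter.up G (⇒-monoʳ (x≤x∨y _ _)) p) (Filter.up G (⇒-monoʳ (y≤x∨y _ _)) p')) }
    }

  ∘⇒ⁱ : ∀ F G I → (F ∘ G) ≬ I → G ≬ (F ⇒ⁱ I)
  ∘⇒ⁱ F G I (b , (a , Fa , p) , Ib) = a ⇒ b , p , lift (a , b , Fa , Ib , ≤-refl)

  ⇒ⁱ∘ : ∀ F G I → G ≬ (F ⇒ⁱ I) → (F ∘ G) ≬ I
  ⇒ⁱ∘ F G I (d , Gd , lift (a , b , Fa , Ib , q)) = b , (a , Fa , Filter.up G q Gd) , Ib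

  -- The fixed factor `G` comes first, as `Residual` requires for `flip _∘_`.
  ∘⇐ⁱ : ∀ G F I → (F ∘ G) ≬ I → F ≬ (G ⇐ⁱ I)
  ∘⇐ⁱ G F I (b , (a , Fa , p) , Ib) = a , Fa , b , Ib , p

  ⇐ⁱ∘ : ∀ G F I → F ≬ (G ⇐ⁱ I) → (F ∘ G) ≬ I
  ⇐ⁱ∘ G F I (a , Fa , b , Ib , p) = b , (a , Fa , p) , Ib

module StableResiduated {c ℓ₁ ℓ₂} (L : ImplicativeLattice c ℓ₁ ℓ₂) where
  private module L = ImplicativeLattice L
  open Polarity L.boundedLattice
  open StableSets L.boundedLattice
  open ImplicationFilters L
  open Residual _∘_ _⇒ⁱ_ ∘⇒ⁱ ⇒ⁱ∘ public
    renaming (residual to _⧹_; residual-mono to ⧹-mono)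
  open Residual (flip _∘_) _⇐ⁱ_ ∘⇐ⁱ ⇐ⁱ∘ public
    renaming (residual to rightResidual; residual-mono to rightResidual-mono)

  -- Equality of filters is enough, as `closure` adds all larger filters, and matching on `refl`
  -- eliminates `H`.
  Product : Stable → Stable → Filter → Set (lsuc size)
  Product x y H = Σ Filter λ F → Σ Filter λ G → mem x F × mem y G × H ≡ F ∘ G

  _·_ : Stable → Stable → Stable
  x · y = closure (Product x y)

  ·-mono : ∀ {x x' y y'} → x ⊑ x' → y ⊑ y' → x · y ⊑ x' · y'
  ·-mono {x} {x'} {y} {y'} p q = closure-least _ (x' · y') λ
    { H (F , G , Fx , Gy , r) → closure-incl _ H (F , G , p F Fx , q G Gy , r) }

  stableResiduated : IntegralResiduatedLattice (lsuc (lsuc size)) (lsuc size) (lsuc size)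
  stableResiduated = record
    { boundedLattice = stableLattice
    ; _·_ = _·_
    ; _⧹_ = _⧹_
    ; _⧸_ = flip rightResidual
    ; ·-cong = λ {x} {x'} {y} {y'} p q →
        ·-mono {x} {x'} {y} {y'} (proj₁ p) (proj₁ q) , ·-mono {x'} {x} {y'} {y} (proj₂ p) (proj₂ q)
    ; ⧹-cong = λ {x} {x'} {y} {y'} p q →
        ⧹-mono {x} {x'} {y} {y'} (proj₂ p) (proj₁ q) , ⧹-mono {x'} {x} {y'} {y} (proj₁ p) (proj₂ q)
    ; ⧸-cong = λ {y} {y'} {x} {x'} q p →
        rightResidual-mono {x} {x'} {y} {y'} (proj₂ p) (proj₁ q) ,
        rightResidual-mono {x'} {x} {y'} {y} (proj₁ p) (proj₂ q)
    ; residuated₁ = λ x y z →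
        (λ h G Gy F Fx → h (F ∘ G) (closure-incl _ (F ∘ G) (F , G , Fx , Gy , refl))) ,
        (λ h → closure-least (Product x y) z λ { _ (F , G , Fx , Gy , refl) → h G Gy F Fx })
    ; residuated₂ = λ x y z →
        (λ h F Fx G Gy → h (F ∘ G) (closure-incl _ (F ∘ G) (F , G , Fx , Gy , refl))) ,
        (λ h → closure-least (Product x y) z λ { _ (F , G , Fx , Gy , refl) → h F Fx G Gy })
    -- By A3, `a ⇒ a` lies in every `G`, so `F ⊆ F ∘ G`. Conversely `a ⇒ b` in `↑ ⊤` forces `a ≤ b`,
    -- so `F ∘ ↑ ⊤ ⊆ F`.
    ; integral = λ x →
        closure-least (Product x ⊤ˢ) x (λ { _ (F , G , Fx , _ , refl) →
          upset x (λ a Fa → a , Fa , ⇒-true G ≤-refl) Fx }) ,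
        (λ F Fx → upset (x · ⊤ˢ) {F ∘ ↑ L.⊤} {F}
          (λ { b (a , Fa , lift p) → Filter.up F (proj₂ (L.A3 a b) p) Fa })
          (closure-incl (Product x ⊤ˢ) (F ∘ ↑ L.⊤) (F , ↑ L.⊤ , Fx , lift tt , refl)))
    }
    where ⊤ˢ = BoundedLattice.⊤ stableLattice

  -- For the converse the test filter is `↑ a`: it gives `a' ⇒ b` in `G` for some `a'` above `a`,
  -- and antitonicity gives `a ⇒ b`.
  embed-⇒ : ∀ a b → embed (a L.⇒ b) ≋ (embed a ⧹ embed b)
  embed-⇒ a b =
    (λ { G (lift p) F (lift Fa) → lift (a , Fa , p) }) ,
    (λ G h → let a' , lift a≤a' , p = lower (h (↑ a) (lift (lift ≤-refl)))
             in lift (Filter.up G (⇒-monoˡ a≤a') p))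

-- Implication laws from residuation

module ResiduatedProperties {c ℓ₁ ℓ₂} (R : IntegralResiduatedLattice c ℓ₁ ℓ₂) where
  open IntegralResiduatedLattice R

  ⧹-intro : ∀ {x y z} → x · y ≤ z → y ≤ x ⧹ z
  ⧹-intro = proj₁ (residuated₁ _ _ _)

  ⧹-elim : ∀ {x y z} → y ≤ x ⧹ z → x · y ≤ z
  ⧹-elim = proj₂ (residuated₁ _ _ _)

  ⧸-intro : ∀ {x y z} → x · y ≤ z → x ≤ z ⧸ y
  ⧸-intro = proj₁ (residuated₂ _ _ _)

  ⧸-elim : ∀ {x y z} → x ≤ z ⧸ y → x · y ≤ z
  ⧸-elim = proj₂ (residuated₂ _ _ _)

  -- For fixed `z` the residuals form an antitone Galois connection, which yields the laws for the
  -- first argument of `⧹`.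
  ≤⧹⇔≤⧸ : ∀ {x y z} → (y ≤ x ⧹ z → x ≤ z ⧸ y) × (x ≤ z ⧸ y → y ≤ x ⧹ z)
  ≤⧹⇔≤⧸ = (λ p → ⧸-intro (⧹-elim p)) , (λ p → ⧹-intro (⧸-elim p))

  ⧹-monoʳ : ∀ {x y z} → y ≤ z → x ⧹ y ≤ x ⧹ z
  ⧹-monoʳ p = ⧹-intro (trans (⧹-elim (reflexive Eq.refl)) p)

  ⧹-antiˡ : ∀ {x y z} → x ≤ y → y ⧹ z ≤ x ⧹ z
  ⧹-antiˡ p = proj₂ ≤⧹⇔≤⧸ (trans p (proj₁ ≤⧹⇔≤⧸ (reflexive Eq.refl)))

  ⧹-∨ : ∀ x y z → ((x ∨ y) ⧹ z) ≈ ((x ⧹ z) ∧ (y ⧹ z))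
  ⧹-∨ x y z = antisym
    (∧-greatest (⧹-antiˡ (x≤x∨y x y)) (⧹-antiˡ (y≤x∨y x y)))
    (proj₂ ≤⧹⇔≤⧸ (∨-least (proj₁ ≤⧹⇔≤⧸ (x∧y≤x _ _)) (proj₁ ≤⧹⇔≤⧸ (x∧y≤y _ _))))

  ⧹-∧ : ∀ x y z → (x ⧹ (y ∧ z)) ≈ ((x ⧹ y) ∧ (x ⧹ z))
  ⧹-∧ x y z = antisym
    (∧-greatest (⧹-monoʳ (x∧y≤x y z)) (⧹-monoʳ (x∧y≤y y z)))
    (⧹-intro (∧-greatest (⧹-elim (x∧y≤x _ _)) (⧹-elim (x∧y≤y _ _))))

  ⊤≤⧹ : ∀ x y → (x ≤ y → ⊤ ≤ x ⧹ y) × (⊤ ≤ x ⧹ y → x ≤ y)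
  ⊤≤⧹ x y =
    (λ p → ⧹-intro (trans (reflexive (integral x)) p)) ,
    (λ p → trans (reflexive (Eq.sym (integral x))) (⧹-elim p))

-- Heyting implication in the distributive case

module StableHeyting {c ℓ₁ ℓ₂} (D : DistributiveImplicativeLattice c ℓ₁ ℓ₂) where
  open DistributiveImplicativeLattice D
  open Polarity boundedLattice
  open StableSets boundedLattice
  open StableResiduated implicativeLattice using (stableResiduated)

  _∨ᶠ_ : Filter → Filter → Filter
  F ∨ᶠ G = record
    { mem = λ d → Lift size (Σ Carrier λ a → Σ Carrier λ b → a ∈ᶠ F × b ∈ᶠ G × a ∧ b ≤ d)
    ; up = λ { p (lift (a , b , Fa , Gb , q)) → lift (a , b , Fa , Gb , trans q p) }
    ; ⊤-mem = lift (⊤ , ⊤ , Filter.⊤-mem F , Filter.⊤-mem G , maximum _)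
    ; ∧-mem = λ { (lift (a , b , Fa , Gb , q)) (lift (a' , b' , Fa' , Gb' , q')) →
        lift (a ∧ a' , b ∧ b' , Filter.∧-mem F Fa Fa' , Filter.∧-mem G Gb Gb' ,
          ∧-greatest (trans (∧-mono (x∧y≤x _ _) (x∧y≤x _ _)) q)
                     (trans (∧-mono (x∧y≤y _ _) (x∧y≤y _ _)) q')) }
    }

  _⇨ⁱ_ : Filter → Ideal → Ideal
  F ⇨ⁱ I = record
    { mem = λ b → Σ Carrier λ a → a ∈ᶠ F × (a ∧ b) ∈ⁱ I
    ; down = λ { p (a , Fa , q) → a , Fa , Ideal.down I (∧-mono ≤-refl p) q }
    ; ⊥-mem = ⊤ , Filter.⊤-mem F , Ideal.down I (x∧y≤y _ _) (Ideal.⊥-mem I)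
    -- Distributivity of `D` puts `(a ∧ a') ∧ (b ∨ b')` below `(a ∧ b) ∨ (a' ∧ b')`.
    ; ∨-mem = λ { (a , Fa , p) (a' , Fa' , p') →
        a ∧ a' , Filter.∧-mem F Fa Fa' ,
        Ideal.down I
          (trans (reflexive (∧-distribˡ-∨ _ _ _))
            (∨-mono (∧-mono (x∧y≤x _ _) ≤-refl) (∧-mono (x∧y≤y _ _) ≤-refl)))
          (Ideal.∨-mem I p p') }
    }

  ∨ᶠ⇨ⁱ : ∀ F G I → (F ∨ᶠ G) ≬ I → G ≬ (F ⇨ⁱ I)
  ∨ᶠ⇨ⁱ F G I (d , lift (a , b , Fa , Gb , p) , Id) = b , Gb , a , Fa , Ideal.down I p Id

  ⇨ⁱ∨ᶠ : ∀ F G I → G ≬ (F ⇨ⁱ I) → (F ∨ᶠ G) ≬ I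
  ⇨ⁱ∨ᶠ F G I (b , Gb , a , Fa , Iab) = a ∧ b , lift (a , b , Fa , Gb , ≤-refl) , Iab

  open Residual _∨ᶠ_ _⇨ⁱ_ ∨ᶠ⇨ⁱ ⇨ⁱ∨ᶠ using () renaming (residual to _⇨_)

  private module S = BoundedLattice stableLattice

  stable-isHeyting : IsHeytingAlgebra S._≈_ S._≤_ S._∨_ S._∧_ _⇨_ S.⊤ S.⊥
  stable-isHeyting = record
    { isBoundedLattice = S.isBoundedLattice
    -- `F ∨ᶠ G` contains both factors, so it belongs to `w ⊓ x`; conversely `F ∨ᶠ F ⊆ F`.
    ; exponential = λ w x y →
        (λ h G Gw F Fx → h (F ∨ᶠ G)
          ( upset w (λ b Gb → lift (⊤ , b , Filter.⊤-mem F , Gb , x∧y≤y _ _)) Gw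
          , upset x (λ a Fa → lift (a , ⊤ , Fa , Filter.⊤-mem G , x∧y≤x _ _)) Fx)) ,
        (λ { h F (Fw , Fx) → upset y
          (λ { d (lift (a , b , Fa , Fb , p)) → Filter.up F p (Filter.∧-mem F Fa Fb) })
          (h F Fw F Fx) })
    }

  heytingAlgebra : HeytingAlgebra (lsuc (lsuc size)) (lsuc size) (lsuc size)
  heytingAlgebra = record { isHeytingAlgebra = stable-isHeyting }

  open ResiduatedProperties stableResiduated using (⧹-∨; ⧹-∧; ⊤≤⧹)

  stableHeyting : ResiduatedHeytingAlgebra (lsuc (lsuc size)) (lsuc size) (lsuc size)
  stableHeyting = record
    { residuatedLattice = stableResiduated
    ; _⇨_ = _⇨_
    ; isHeytingAlgebra = stable-isHeyting
    ; ∧-distribˡ-∨ = HeytingProperties.∧-distribˡ-∨ heytingAlgebra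
    ; ⧹-A1 = ⧹-∨
    ; ⧹-A2 = ⧹-∧
    ; ⧹-A3 = ⊤≤⧹
    }

-- Arbitrary canonical extensions

module CanonicalExtension (em : ExcludedMiddle) {c ℓ₁ ℓ₂ c' ℓ₁' ℓ₂'}
  (L : BoundedLattice c ℓ₁ ℓ₂) (C : BoundedLattice c' ℓ₁' ℓ₂')
  (e : BoundedLattice.Carrier L → BoundedLattice.Carrier C)
  (canonical : IsCanonicalExtension L C (c ⊔ ℓ₁ ⊔ ℓ₂) (lsuc (c ⊔ ℓ₁ ⊔ ℓ₂)) e)
  where
  private
    module L = BoundedLattice L
    module C = BoundedLattice C
  open IsCanonicalExtension canonical
  open Resizing em
  open Polarity L
  open StableSets L

  e-mono : ∀ {a b} → a L.≤ b → e a C.≤ e b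
  e-mono {a} {b} p = C.trans (C.x≤x∨y (e a) (e b))
    (C.reflexive (C.Eq.trans (C.Eq.sym (e-∨ a b))
      (e-cong (JoinProperties.x≤y⇒x∨y≈y L.joinSemilattice p))))

  private
    meet : ∀ F → Σ C.Carrier (IsGlb C λ (p : Lift (lsuc size) (Σ L.Carrier (_∈ᶠ F))) → e (proj₁ (lower p)))
    meet F = complete-∧ _ _

    join : ∀ I → Σ C.Carrier (IsLub C λ (p : Lift (lsuc size) (Σ L.Carrier (_∈ⁱ I))) → e (proj₁ (lower p)))
    join I = complete-∨ _ _

  κ : Filter → C.Carrier
  κ F = proj₁ (meet F)

  ω : Ideal → C.Carrier
  ω I = proj₁ (join I)

  κ-lower : ∀ F {a} → a ∈ᶠ F → κ F C.≤ e a
  κ-lower F Fa = proj₁ (proj₂ (meet F)) (lift (_ , Fa))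

  κ-greatest : ∀ F {u} → (∀ a → a ∈ᶠ F → u C.≤ e a) → u C.≤ κ F
  κ-greatest F h = proj₂ (proj₂ (meet F)) _ λ { (lift (a , Fa)) → h a Fa }

  ω-upper : ∀ I {a} → a ∈ⁱ I → e a C.≤ ω I
  ω-upper I Ia = proj₁ (proj₂ (join I)) (lift (_ , Ia))

  ω-least : ∀ I {u} → (∀ a → a ∈ⁱ I → e a C.≤ u) → ω I C.≤ u
  ω-least I h = proj₂ (proj₂ (join I)) _ λ { (lift (a , Ia)) → h a Ia }

  -- Completeness uses indices of level `lsuc size`; dropping the lift gives the level `size` of
  -- `compact` and `IsClosed`.
  κ-glb : ∀ F → IsGlb C {I = Σ L.Carrier (_∈ᶠ F)} (λ p → e (proj₁ p)) (κ F)
  κ-glb F = (λ { (_ , Fa) → κ-lower F Fa }) , (λ u h → κ-greatest F λ a Fa → h (a , Fa))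

  ω-lub : ∀ I → IsLub C {I = Σ L.Carrier (_∈ⁱ I)} (λ p → e (proj₁ p)) (ω I)
  ω-lub I = (λ { (_ , Ia) → ω-upper I Ia }) , (λ u h → ω-least I λ a Ia → h (a , Ia))

  ≬⇒κ≤ω : ∀ F I → F ≬ I → κ F C.≤ ω I
  ≬⇒κ≤ω F I (a , Fa , Ia) = C.trans (κ-lower F Fa) (ω-upper I Ia)

  -- The common element is the finite meet that compactness provides: it is in `F`, and it is below
  -- a finite join from `I`.
  κ≤ω⇒≬ : ∀ F I → κ F C.≤ ω I → F ≬ I
  κ≤ω⇒≬ F I p =
    let is , js , q = compact _ _ proj₁ proj₁ (κ F) (ω I) (κ-glb F) (ω-lub I) p
    in _ , ⋀-mem F is , Ideal.down I q (⋁-mem I js)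

  κ≤e⇒∈ : ∀ F {a} → κ F C.≤ e a → a ∈ᶠ F
  κ≤e⇒∈ F {a} p = ≬-↓ {F} (κ≤ω⇒≬ F (↓ a) (C.trans p (ω-upper (↓ a) (lift ≤-refl))))

  e≤ω⇒∈ : ∀ I {a} → e a C.≤ ω I → a ∈ⁱ I
  e≤ω⇒∈ I {a} p = ↑-≬ {I = I} (κ≤ω⇒≬ (↑ a) I (C.trans (κ-lower (↑ a) (lift ≤-refl)) p))

  -- The index sets of the density axioms are one level too large for
  -- compactness; resizing replaces them by genuine filters and ideals.
  filterAbove : C.Carrier → Filter
  filterAbove x = record
    { mem = λ a → Resize size (x C.≤ e a)
    ; up = λ p q → shrink (C.trans (unshrink q) (e-mono p))
    ; ⊤-mem = shrink (C.trans (C.maximum x) (C.reflexive (C.Eq.sym e-⊤)))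
    ; ∧-mem = λ p q → shrink (C.trans (C.∧-greatest (unshrink p) (unshrink q))
                                      (C.reflexive (C.Eq.sym (e-∧ _ _))))
    }

  idealBelow : C.Carrier → Ideal
  idealBelow x = record
    { mem = λ a → Resize size (e a C.≤ x)
    ; down = λ p q → shrink (C.trans (e-mono p) (unshrink q))
    ; ⊥-mem = shrink (C.trans (C.reflexive e-⊥) (C.minimum x))
    ; ∨-mem = λ p q → shrink (C.trans (C.reflexive (e-∨ _ _))
                                      (C.∨-least (unshrink p) (unshrink q)))
    }

  -- Together with the converse, which holds for every element of `C`, this presents a closed
  -- element by a filter, whatever the level of its original index set.
  κ-filterAbove : ∀ {i} {A : Set i} (S : A → L.Carrier) {k} → IsGlb C (λ j → e (S j)) k →
                  κ (filterAbove k) C.≤ k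
  κ-filterAbove S {k} (lower , greatest) =
    greatest _ λ j → κ-lower (filterAbove k) (shrink (lower j))

  ω-idealBelow : ∀ {i} {A : Set i} (S : A → L.Carrier) {o} → IsLub C (λ j → e (S j)) o →
                 o C.≤ ω (idealBelow o)
  ω-idealBelow S {o} (upper , least) =
    least _ λ j → ω-upper (idealBelow o) (shrink (upper j))

  -- Each closed element in the density presentation of `x` is replaced by `κ` of the filter above
  -- it.
  κ-dense : ∀ x {y} → (∀ F → κ F C.≤ x → κ F C.≤ y) → x C.≤ y
  κ-dense x h with dense-∨∧ x
  ... | J , A , S , m , m-glb , upper , least = least _ λ j →
    C.trans (κ-greatest (filterAbove (m j)) λ a p → unshrink p)
      (h (filterAbove (m j)) (C.trans (κ-filterAbove (S j) (m-glb j)) (upper j)))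

  ω-dense : ∀ {x} y → (∀ I → y C.≤ ω I → x C.≤ ω I) → x C.≤ y
  ω-dense y h with dense-∧∨ y
  ... | J , A , S , m , m-lub , lower , greatest = greatest _ λ j →
    C.trans (h (idealBelow (m j)) (C.trans (lower j) (ω-idealBelow (S j) (m-lub j))))
      (ω-least (idealBelow (m j)) λ a p → unshrink p)

  ≤ω-intro : ∀ x I → (∀ F → κ F C.≤ x → F ≬ I) → x C.≤ ω I
  ≤ω-intro x I h = κ-dense x λ F p → ≬⇒κ≤ω F I (h F p)

  to : Stable → C.Carrier
  to x = proj₁ (complete-∨ (Σ Filter (mem x)) λ p → κ (proj₁ p))

  to-upper : ∀ x F → mem x F → κ F C.≤ to x
  to-upper x F p = proj₁ (proj₂ (complete-∨ (Σ Filter (mem x)) λ q → κ (proj₁ q))) (F , p)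

  to-least : ∀ x {u} → (∀ F → mem x F → κ F C.≤ u) → to x C.≤ u
  to-least x h = proj₂ (proj₂ (complete-∨ (Σ Filter (mem x)) λ q → κ (proj₁ q))) _
    λ { (F , p) → h F p }

  from : C.Carrier → Stable
  from y = record
    { mem = λ F → Resize (lsuc size) (κ F C.≤ y)
    -- Every `I` with `y` below `ω I` bounds this set, so `F` meets it; these `ω I` have meet `y`.
    ; stable = λ F h → shrink (ω-dense y λ I p →
        ≬⇒κ≤ω F I (h I λ G q → κ≤ω⇒≬ G I (C.trans (unshrink q) p)))
    }

  to-mono : ∀ {x y} → x ⊑ y → to x C.≤ to y
  to-mono {x} {y} p = to-least x λ F q → to-upper y F (p F q)

  from-mono : ∀ {x y} → x C.≤ y → from x ⊑ from y
  from-mono p F q = shrink (C.trans (unshrink q) p)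

  -- If `I` bounds `x`, then `to x` is below `ω I`. So a filter with `κ F` below `to x` meets every
  -- bounding ideal, and stability puts it in `x`.
  from-to : ∀ x → from (to x) ≋ x
  from-to x =
    (λ F p → stable x F λ I b → κ≤ω⇒≬ F I
      (C.trans (unshrink p) (to-least x λ G q → ≬⇒κ≤ω G I (b G q)))) ,
    (λ F p → shrink (to-upper x F p))

  to-from : ∀ y → to (from y) C.≈ y
  to-from y = C.antisym
    (to-least (from y) λ F p → unshrink p)
    (κ-dense y λ F p → to-upper (from y) F (shrink p))

  to-embed : ∀ a → to (embed a) C.≈ e a
  to-embed a = C.antisym
    (to-least (embed a) λ { F (lift Fa) → κ-lower F Fa })
    (C.trans (κ-greatest (↑ a) λ { b (lift p) → e-mono p })
             (to-upper (embed a) (↑ a) (lift (lift ≤-refl))))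

-- The π-extension through filters and ideals

module PiExtension (em : ExcludedMiddle) {c ℓ₁ ℓ₂ c' ℓ₁' ℓ₂'}
  (L : ImplicativeLattice c ℓ₁ ℓ₂) (C : BoundedLattice c' ℓ₁' ℓ₂')
  (e : ImplicativeLattice.Carrier L → BoundedLattice.Carrier C)
  (canonical : IsCanonicalExtension (ImplicativeLattice.boundedLattice L) C
                 (c ⊔ ℓ₁ ⊔ ℓ₂) (lsuc (c ⊔ ℓ₁ ⊔ ℓ₂)) e)
  where
  private
    module L = ImplicativeLattice L
    module C = BoundedLattice C
  open Resizing em
  open Polarity L.boundedLattice
  open ImplicationFilters L
  open CanonicalExtension em L.boundedLattice C e canonical

  Approximants : C.Carrier → C.Carrier → C.Carrier → Set (lsuc size ⊔ c' ⊔ ℓ₁' ⊔ ℓ₂')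
  Approximants x y w = Σ C.Carrier λ k → Σ C.Carrier λ o →
    IsClosed L.boundedLattice C size e k × IsOpen L.boundedLattice C size e o ×
    k C.≤ x × y C.≤ o ×
    IsLubOf C (λ v → Σ L.Carrier λ a → Σ L.Carrier λ b →
                 (k C.≤ e a) × (e b C.≤ o) × (v C.≈ e (a L.⇒ b))) w

  -- Criterion for `κ F` to lie below the π-extension at `x` and `y`: the approximant given by `κ G`
  -- and `ω I` is `ω (G ⇒ⁱ I)`, and compactness turns `κ F` below it into meeting.
  Residuates : Filter → C.Carrier → C.Carrier → Set (lsuc size ⊔ ℓ₂')
  Residuates F x y = ∀ G I → κ G C.≤ x → y C.≤ ω I → F ≬ (G ⇒ⁱ I)

  κ≤approximant : ∀ F x y {w} → Residuates F x y → Approximants x y w → κ F C.≤ w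
  κ≤approximant F x y h (k , o , (_ , S , k-glb) , (_ , T , o-lub) , k≤x , y≤o , upper , _)
    with h (filterAbove k) (idealBelow o)
           (C.trans (κ-filterAbove S k-glb) k≤x) (C.trans y≤o (ω-idealBelow T o-lub))
  ... | d , Fd , lift (a , b , p , q , d≤a⇒b) =
    C.trans (κ-lower F Fd) (C.trans (e-mono d≤a⇒b)
      (upper _ (a , b , unshrink p , unshrink q , C.Eq.refl)))

  -- Compactness identifies the `a` with `e a` above `κ G` as the elements of `G`, and dually for
  -- `I`, so the join runs over a cofinal part of `G ⇒ⁱ I`.
  ω⇒ⁱ-approximant : ∀ {x y} G I → κ G C.≤ x → y C.≤ ω I → Approximants x y (ω (G ⇒ⁱ I))
  ω⇒ⁱ-approximant G I p q =
    κ G , ω I , (_ , _ , κ-glb G) , (_ , _ , ω-lub I) , p , q ,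
    (λ { w (a , b , r , s , w≈) → C.trans (C.reflexive w≈)
           (ω-upper (G ⇒ⁱ I) (lift (a , b , κ≤e⇒∈ G r , e≤ω⇒∈ I s , ≤-refl))) }) ,
    (λ u h → ω-least (G ⇒ⁱ I) λ { d (lift (a , b , Ga , Ib , r)) →
       C.trans (e-mono r) (h _ (a , b , κ-lower G Ga , ω-upper I Ib , C.Eq.refl)) })

  module _ {g : C.Carrier → C.Carrier → C.Carrier}
    (π : IsPiExtension⇒ L.boundedLattice C size e L._⇒_ g) where

    κ≤π⇒residuates : ∀ F x y → κ F C.≤ g x y → Residuates F x y
    κ≤π⇒residuates F x y h G I p q = κ≤ω⇒≬ F (G ⇒ⁱ I)
      (C.trans h (proj₁ (π x y) _ (ω⇒ⁱ-approximant G I p q)))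

    residuates⇒κ≤π : ∀ F x y → Residuates F x y → κ F C.≤ g x y
    residuates⇒κ≤π F x y h = proj₂ (π x y) _ λ w → κ≤approximant F x y h

  isPiExtension : {g : C.Carrier → C.Carrier → C.Carrier} →
    (∀ F x y → κ F C.≤ g x y → Residuates F x y) →
    (∀ F x y → Residuates F x y → κ F C.≤ g x y) →
    IsPiExtension⇒ L.boundedLattice C size e L._⇒_ g
  isPiExtension {g} ⇒r r⇒ x y =
    (λ w a → κ-dense (g x y) λ F p → κ≤approximant F x y (⇒r F x y p) a) ,
    (λ u h → κ-dense u λ F p → r⇒ F x y λ G I q r →
       κ≤ω⇒≬ F (G ⇒ⁱ I) (C.trans p (h _ (ω⇒ⁱ-approximant G I q r))))

-- The residual of stable sets is the π-extension

module StableCanonical (em : ExcludedMiddle) {c ℓ₁ ℓ₂} (L : ImplicativeLattice c ℓ₁ ℓ₂) where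
  private module L = ImplicativeLattice L
  open Polarity L.boundedLattice
  open StableSets L.boundedLattice
  open ImplicationFilters L
  open StableResiduated L
  open CanonicalExtension em L.boundedLattice stableLattice embed embed-canonical
  open PiExtension em L stableLattice embed embed-canonical

  -- `κ F` unfolds to the intersection of the sets `embed a` over `F`, so its members are the
  -- filters containing `F`.
  κ-mem : ∀ F → mem (κ F) F
  κ-mem F (lift (a , Fa)) = lift Fa

  κ⊑ : ∀ F x → mem x F → κ F ⊑ x
  κ⊑ F x p G h = upset x (λ a Fa → lower (h (lift (a , Fa)))) p

  ⊑ω : ∀ I x → mem x BoundedBy I → x ⊑ ω I
  ⊑ω I x b F p J h =
    let a , Fa , Ia = b F p in h F (lift (a , Ia) , lift Fa)

  stableCanonical : IsCanonicalResExt L stableResiduated embed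
  stableCanonical = record
    { canonical = embed-canonical
    ; e-⇒ = embed-⇒
    -- For stable sets `κ G ⊑ x` means that `G` is in `x`, so by the adjunction `Residuates F x y`
    -- says that `G ∘ F` is in `y` for all such `G`.
    ; ⧹-is-π = isPiExtension {_⧹_}
        (λ F x y h G I p q → ∘⇒ⁱ G F I
           (κ≤ω⇒≬ (G ∘ F) I λ H r → q H (κ⊑ (G ∘ F) y (h F (κ-mem F) G (p G (κ-mem G))) H r)))
        (λ F x y h → κ⊑ F (x ⧹ y) λ G Gx → stable y (G ∘ F) λ I b →
           ⇒ⁱ∘ G F I (h G I (κ⊑ G x Gx) (⊑ω I y b)))
    }

-- Isomorphisms

module OrderIsomorphism {c ℓ₁ ℓ₂ c' ℓ₁' ℓ₂'}
  (A : BoundedLattice c ℓ₁ ℓ₂) (B : BoundedLattice c' ℓ₁' ℓ₂')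
  (to : BoundedLattice.Carrier A → BoundedLattice.Carrier B)
  (from : BoundedLattice.Carrier B → BoundedLattice.Carrier A)
  (to-mono : ∀ {x y} → BoundedLattice._≤_ A x y → BoundedLattice._≤_ B (to x) (to y))
  (from-mono : ∀ {x y} → BoundedLattice._≤_ B x y → BoundedLattice._≤_ A (from x) (from y))
  (from-to : ∀ x → BoundedLattice._≈_ A (from (to x)) x)
  (to-from : ∀ y → BoundedLattice._≈_ B (to (from y)) y)
  where
  private
    module A = BoundedLattice A
    module B = BoundedLattice B

  to-cong : ∀ {x y} → x A.≈ y → to x B.≈ to y
  to-cong p = B.antisym (to-mono (A.reflexive p)) (to-mono (A.reflexive (A.Eq.sym p)))

  from-cong : ∀ {x y} → x B.≈ y → from x A.≈ from y
  from-cong p = A.antisym (from-mono (B.reflexive p)) (from-mono (B.reflexive (B.Eq.sym p)))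

  -- `from` is both left and right adjoint to `to`, so `to` preserves meets and joins.
  ≤to : ∀ {x y} → from y A.≤ x → y B.≤ to x
  ≤to p = B.trans (B.reflexive (B.Eq.sym (to-from _))) (to-mono p)

  from≤ : ∀ {x y} → y B.≤ to x → from y A.≤ x
  from≤ p = A.trans (from-mono p) (A.reflexive (from-to _))

  to≤ : ∀ {x y} → x A.≤ from y → to x B.≤ y
  to≤ p = B.trans (to-mono p) (B.reflexive (to-from _))

  ≤from : ∀ {x y} → to x B.≤ y → x A.≤ from y
  ≤from p = A.trans (A.reflexive (A.Eq.sym (from-to _))) (from-mono p)

  to-order : ∀ x y → (x A.≤ y → to x B.≤ to y) × (to x B.≤ to y → x A.≤ y)
  to-order x y = to-mono , λ p → A.trans (≤from p) (A.reflexive (from-to y))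

  to-∧ : ∀ x y → to (x A.∧ y) B.≈ (to x B.∧ to y)
  to-∧ x y = B.antisym
    (B.∧-greatest (to-mono (A.x∧y≤x x y)) (to-mono (A.x∧y≤y x y)))
    (≤to (A.∧-greatest (from≤ (B.x∧y≤x _ _)) (from≤ (B.x∧y≤y _ _))))

  to-∨ : ∀ x y → to (x A.∨ y) B.≈ (to x B.∨ to y)
  to-∨ x y = B.antisym
    (to≤ (A.∨-least (≤from (B.x≤x∨y _ _)) (≤from (B.y≤x∨y _ _))))
    (B.∨-least (to-mono (A.x≤x∨y x y)) (to-mono (A.y≤x∨y x y)))

  to-⊤ : to A.⊤ B.≈ B.⊤
  to-⊤ = B.antisym (B.maximum _) (≤to (A.maximum _))

  to-⊥ : to A.⊥ B.≈ B.⊥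
  to-⊥ = B.antisym (to≤ (A.minimum _)) (B.minimum _)

  module _
    (_⊗_ _/_ : A.Carrier → A.Carrier → A.Carrier)
    (_⊗'_ _/'_ : B.Carrier → B.Carrier → B.Carrier)
    (res : ∀ x y z → ((x ⊗ y) A.≤ z → x A.≤ (z / y)) × (x A.≤ (z / y) → (x ⊗ y) A.≤ z))
    (res' : ∀ x y z → ((x ⊗' y) B.≤ z → x B.≤ (z /' y)) × (x B.≤ (z /' y) → (x ⊗' y) B.≤ z))
    where
    private
      A-refl : ∀ {x} → x A.≤ x
      A-refl = A.reflexive A.Eq.refl

    -- Each member of a residuated pair determines the other, so an order isomorphism preserving one
    -- preserves both.
    preserves-residual : (∀ x y → to (x ⊗ y) B.≈ (to x ⊗' to y)) →
                         ∀ x y → to (x / y) B.≈ (to x /' to y)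
    preserves-residual to-⊗ x y = B.antisym
      (proj₁ (res' _ _ _) (B.trans (B.reflexive (B.Eq.sym (to-⊗ _ _)))
                                   (to-mono (proj₂ (res _ _ _) A-refl))))
      (≤to (proj₁ (res _ _ _) (proj₂ (to-order _ _) (B.trans (B.reflexive (to-⊗ _ _))
             (proj₂ (res' _ _ _) (to≤ A-refl))))))

    preserves-residuated : (∀ x y → to (x / y) B.≈ (to x /' to y)) →
                           ∀ x y → to (x ⊗ y) B.≈ (to x ⊗' to y)
    preserves-residuated to-/ x y = B.antisym
      (to≤ (proj₂ (res _ _ _) (proj₂ (to-order _ _) (B.trans
        (proj₁ (res' _ _ _) (≤to A-refl)) (B.reflexive (B.Eq.sym (to-/ _ _)))))))
      (proj₂ (res' _ _ _) (B.trans (to-mono (proj₁ (res _ _ _) A-refl)) (B.reflexive (to-/ _ _))))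

module Uniqueness (em : ExcludedMiddle) {c ℓ₁ ℓ₂ c' ℓ₁' ℓ₂'}
  (L : ImplicativeLattice c ℓ₁ ℓ₂) (R' : IntegralResiduatedLattice c' ℓ₁' ℓ₂')
  (e : ImplicativeLattice.Carrier L → IntegralResiduatedLattice.Carrier R')
  (ext : IsCanonicalResExt L R' e)
  where
  private
    module L = ImplicativeLattice L
    module R' = IntegralResiduatedLattice R'
  open IsCanonicalResExt ext
  open Resizing em
  open Polarity L.boundedLattice
  open StableSets L.boundedLattice
  open ImplicationFilters L
  open StableResiduated L
  private
    module R = IntegralResiduatedLattice stableResiduated
  open CanonicalExtension em L.boundedLattice R'.boundedLattice e canonical
  open PiExtension em L R'.boundedLattice e canonical
  open OrderIsomorphism stableLattice R'.boundedLattice to from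
    (λ {x} {y} → to-mono {x} {y}) from-mono from-to to-from public

  -- Both memberships of `F` express `Residuates F x y`: on the left by the π-extension, on the
  -- right by the adjunction between `∘` and `⇒ⁱ`.
  from-⧹ : ∀ x y → from (x R'.⧹ y) ≋ (from x ⧹ from y)
  from-⧹ x y =
    (λ F p G q → stable (from y) (G ∘ F) λ I b → ⇒ⁱ∘ G F I
      (κ≤π⇒residuates ⧹-is-π F x y (unshrink p) G I (unshrink q)
        (≤ω-intro y I λ H r → b H (shrink r)))) ,
    (λ F h → shrink (residuates⇒κ≤π ⧹-is-π F x y λ G I p q → ∘⇒ⁱ G F I
      (κ≤ω⇒≬ (G ∘ F) I (R'.trans (unshrink (h G (shrink p))) q))))

  to-⧹ : ∀ x y → to (x ⧹ y) R'.≈ (to x R'.⧹ to y)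
  to-⧹ x y = R'.Eq.trans
    (to-cong {x ⧹ y} {from (to x R'.⧹ to y)}
      (R.Eq.trans {x ⧹ y} {from (to x) ⧹ from (to y)} {from (to x R'.⧹ to y)}
        (R.⧹-cong {x} {from (to x)} {y} {from (to y)}
          (R.Eq.sym {from (to x)} {x} (from-to x)) (R.Eq.sym {from (to y)} {y} (from-to y)))
        (R.Eq.sym {from (to x R'.⧹ to y)} {from (to x) ⧹ from (to y)} (from-⧹ (to x) (to y)))))
    (to-from _)

  -- `⧹` is adjoint in the second factor, whereas the residuation lemmas use the first; hence the
  -- flips.
  to-· : ∀ x y → to (x · y) R'.≈ (to x R'.· to y)
  to-· = flip (preserves-residuated (flip _·_) (flip _⧹_) (flip R'._·_) (flip R'._⧹_)
    (λ x y z → R.residuated₁ y x z) (λ x y z → R'.residuated₁ y x z) (flip to-⧹))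

  iso : IsoFixing stableResiduated R' embed e
  iso = record
    { to = to
    ; from = from
    ; to-cong = λ {x} {y} → to-cong {x} {y}
    ; from-cong = from-cong
    ; from-to = from-to
    ; to-from = to-from
    ; to-order = to-order
    ; to-∧ = to-∧
    ; to-∨ = to-∨
    ; to-⊤ = to-⊤
    ; to-⊥ = to-⊥
    ; to-· = to-·
    ; to-⧹ = to-⧹
    ; to-⧸ = preserves-residual R._·_ R._⧸_ R'._·_ R'._⧸_ R.residuated₂ R'.residuated₂ to-·
    ; fixes = to-embed
    }

theorem2p5 : ExcludedMiddle → ∀ {c ℓ₁ ℓ₂ c' ℓ₁' ℓ₂' : Level} →
    ((L : ImplicativeLattice c ℓ₁ ℓ₂) →
      Σ (IntegralResiduatedLattice (lsuc (lsuc (c ⊔ ℓ₁ ⊔ ℓ₂))) (lsuc (c ⊔ ℓ₁ ⊔ ℓ₂)) (lsuc (c ⊔ ℓ₁ ⊔ ℓ₂))) λ R →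
      Σ (ImplicativeLattice.Carrier L → IntegralResiduatedLattice.Carrier R) λ e →
        IsCanonicalResExt L R e ×
        ((R' : IntegralResiduatedLattice c' ℓ₁' ℓ₂') →
         (e' : ImplicativeLattice.Carrier L → IntegralResiduatedLattice.Carrier R') →
         IsCanonicalResExt L R' e' → IsoFixing R R' e e'))
    ×
    ((D : DistributiveImplicativeLattice c ℓ₁ ℓ₂) →
      Σ (ResiduatedHeytingAlgebra (lsuc (lsuc (c ⊔ ℓ₁ ⊔ ℓ₂))) (lsuc (c ⊔ ℓ₁ ⊔ ℓ₂)) (lsuc (c ⊔ ℓ₁ ⊔ ℓ₂))) λ H →
      Σ (DistributiveImplicativeLattice.Carrier D → ResiduatedHeytingAlgebra.Carrier H) λ e →
        IsCanonicalResExt (DistributiveImplicativeLattice.implicativeLattice D)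
                          (ResiduatedHeytingAlgebra.residuatedLattice H) e ×
        ((H' : ResiduatedHeytingAlgebra c' ℓ₁' ℓ₂') →
         (e' : DistributiveImplicativeLattice.Carrier D → ResiduatedHeytingAlgebra.Carrier H') →
         IsCanonicalResExt (DistributiveImplicativeLattice.implicativeLattice D)
                           (ResiduatedHeytingAlgebra.residuatedLattice H') e' →
         IsoFixingRHA H H' e e'))
theorem2p5 em = residuated , heyting
  where
  residuated = λ L →
    StableResiduated.stableResiduated L , StableSets.embed (ImplicativeLattice.boundedLattice L) ,
    StableCanonical.stableCanonical em L , λ R' e' ext → Uniqueness.iso em L R' e' ext
  heyting = λ D →
    let L = DistributiveImplicativeLattice.implicativeLattice D
        H = StableHeyting.stableHeyting D
        module H = ResiduatedHeytingAlgebra H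
    in H , StableSets.embed (ImplicativeLattice.boundedLattice L) ,
       StableCanonical.stableCanonical em L , λ H' e' ext →
         let module U = Uniqueness em L (ResiduatedHeytingAlgebra.residuatedLattice H') e' ext
             module H' = ResiduatedHeytingAlgebra H'
         -- `⇨` is the residual of `∧`, so preservation of meets carries it along.
         in U.iso , flip (U.preserves-residual H._∧_ (flip H._⇨_) H'._∧_ (flip H'._⇨_)
              (IsHeytingAlgebra.exponential H.isHeytingAlgebra)
              (IsHeytingAlgebra.exponential H'.isHeytingAlgebra) U.to-∧)
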